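{- Let $m\geq 4$ be an integer and let $G$ be an $m$-fragile graph. Then: (1) for all non-adjacent $x,y\in V(G)$, $G$ admits an $m$-colouring $c$ with $c(x)=c(y)$; (2) for all distinct $x,y\in V(G)$, $G$ admits an $m$-colouring $c$ with $c(x)\neq c(y)$; (3) for all distinct $x,y,z\in V(G)$, $G$ admits an $m$-colouring $c$ with $c(x)\notin\{c(y),c(z)\}$; (4) for all distinct $x,y,z\in V(G)$ that are not all pairwise adjacent, $G$ admits an $m$-colouring $c$ with $|\{c(x),c(y),c(z)\}|=2$.
   Context: All graphs are finite and simple. A graph is $k$-connected if it has at least $k+1$ vertices and no vertex cutset with at most $k-1$ vertices. For an integer $m\geq 4$, a graph $G$ is $m$-fragile if every $3$-connected subgraph of $G$ is $(m-1)$-colourable. A $k$-colouring of $G$ is a function $c:V(G)\to\{1,\dots,k\}$ with $c(x)\neq c(y)$ for every edge $xy$. -}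

module Defs where

open import Data.Nat using (ℕ; _<_; _∸_)
open import Data.Fin using (Fin)
open import Data.Fin.Subset using (Subset; _∈_; _∉_; _⊆_; ∣_∣; _─_)
open import Data.Fin.Subset.Properties using (_∈?_; x∈p∧x∉q⇒x∈p─q)
open import Data.Product using (∃-syntax; _×_; _,_; proj₁)
open import Level using (0ℓ; suc)
open import Relation.Binary.Core using (Rel)
open import Relation.Binary.Definitions using (Decidable; Irreflexive; Symmetric)
open import Relation.Binary.Construct.Closure.ReflexiveTransitive using (Star)
open import Relation.Binary.PropositionalEquality using (_≡_; _≢_)
open import Relation.Nullary using (¬_; _×-dec_; ¬?)

-- A finite simple graph whose vertices are drawn from Fin n, so that a graph
-- and its subgraphs (induced or not) share one ambient type.  The vertex set
-- is V, which need not be all of Fin n.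
record Graph (n : ℕ) : Set (suc 0ℓ) where
  field
    V        : Subset n
    E        : Rel (Fin n) 0ℓ
    E-dec    : Decidable E
    E-sym    : Symmetric E
    E-irrefl : Irreflexive _≡_ E
    E⇒∈V     : ∀ {u v} → E u v → u ∈ V

open Graph public

module _ {n : ℕ} where

  Vertex : Graph n → Set
  Vertex G = ∃[ v ] v ∈ V G

  Adjacent : (G : Graph n) → Rel (Vertex G) 0ℓ
  Adjacent G x y = E G (proj₁ x) (proj₁ y)

  infix 4 _⊆ᴳ_
  _⊆ᴳ_ : Graph n → Graph n → Set
  H ⊆ᴳ G = V H ⊆ V G × (∀ {u v} → E H u v → E G u v)

  infixl 6 _∖_
  _∖_ : Graph n → Subset n → Graph n
  G ∖ X = record
    { V        = V G ─ X
    ; E        = λ u v → E G u v × u ∉ X × v ∉ X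
    ; E-dec    = λ u v → E-dec G u v ×-dec ¬? (u ∈? X) ×-dec ¬? (v ∈? X)
    ; E-sym    = λ (e , u∉X , v∉X) → E-sym G e , v∉X , u∉X
    ; E-irrefl = λ eq (e , _) → E-irrefl G eq e
    ; E⇒∈V     = λ (e , u∉X , _) → x∈p∧x∉q⇒x∈p─q (E⇒∈V G e) u∉X
    }

  -- The null graph counts as connected here; this has no effect on
  -- KConnected below, where at least two vertices survive each deletion.
  Connected : Graph n → Set
  Connected G = ∀ (x y : Vertex G) → Star (E G) (proj₁ x) (proj₁ y)

  IsCutset : Graph n → Subset n → Set
  IsCutset G X = X ⊆ V G × ¬ Connected (G ∖ X)

  -- "At most k - 1" is written as "< k", which is also right for k = 0.
  KConnected : ℕ → Graph n → Set
  KConnected k G =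
    k < ∣ V G ∣ × ¬ (∃[ X ] IsCutset G X × ∣ X ∣ < k)

  IsColouring : (G : Graph n) (k : ℕ) → (Vertex G → Fin k) → Set
  IsColouring G k c = ∀ x y → Adjacent G x y → c x ≢ c y

  Colourable : ℕ → Graph n → Set
  Colourable k G = ∃[ c ] IsColouring G k c

  -- Only meant for m ≥ 4, so the truncated subtraction is harmless.
  Fragile : ℕ → Graph n → Set (suc 0ℓ)
  Fragile m G = ∀ H → H ⊆ᴳ G → KConnected 3 H → Colourable (m ∸ 1) H

{-# OPTIONS --safe #-}
module Submission where

-- Induct on a vertex set S, colouring the subgraph induced on it.  If that subgraph is
-- (m - 1)-colourable, give the unused colour to x, or to a non-adjacent pair.  Otherwise it has
-- more than three vertices and is not 3-connected, so it is covered by two smaller pieces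
-- meeting in exactly two vertices u and v.  By induction each piece has colourings in which u, v
-- and a further vertex w are equal or distinct in various patterns, and permuting colours makes
-- two colourings agree on u and v; in every case some pair of available patterns glues to the
-- required colouring.  The only obstruction is a clique on m vertices, for x against two vertices
-- of K₄ when m = 4, and it is excluded by carrying a bound on clique sizes through the induction.

open import Data.Nat as ℕ using (ℕ; zero; suc; _+_; _≤_; _<_; z≤n; s≤s; s≤s⁻¹)
import Data.Nat.Properties as ℕ
open import Data.Fin as Fin using (Fin; zero; suc)
import Data.Fin.Properties as Fin
open import Data.Fin.Permutation using (Permutation′; _⟨$⟩ʳ_; _∘ₚ_; transpose)
  renaming (id to idₚ)
open import Data.Fin.Subset
  using (Subset; _∈_; _∉_; _⊆_; _⊂_; _⊃_; _∩_; _∪_; _─_; _-_; ∁; ⁅_⁆; ∣_∣; Nonempty; inside; outside)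
open import Data.Fin.Subset.Properties
open import Data.Fin.Subset.Induction using (⊂-wellFounded; ⊃-wellFounded)
open import Data.List using (List; []; _∷_; length; lookup)
open import Data.List.Membership.Propositional.Properties using (∈-lookup)
open import Data.List.Relation.Unary.All as All using (All; []; _∷_)
open import Data.List.Relation.Unary.All.Properties using (¬All⇒Any¬)
open import Data.List.Relation.Unary.AllPairs using (AllPairs; []; _∷_)
open import Data.List.Relation.Unary.Any as Any using (Any)
open import Data.List.Relation.Unary.Any.Properties using (lookup-index)
open import Data.Product using (Σ; ∃; ∃-syntax; ∃₂; _×_; _,_; proj₁; proj₂; map₂)
open import Data.Sum as Sum using (_⊎_; inj₁; inj₂; [_,_]′)
open import Data.Vec.Properties.WithK using ([]=-irrelevant)
open import Data.Vec using ([]; _∷_; here; there)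
open import Function using (_∘_; id; const; Inverse)
open import Induction.WellFounded using (Acc; acc)
open import Relation.Binary.Construct.Closure.ReflexiveTransitive using (Star; ε; _◅_; _◅◅_)
open import Relation.Binary.Definitions using (Symmetric)
open import Relation.Binary.PropositionalEquality
  using (_≡_; _≢_; refl; sym; trans; cong; subst; ≢-sym)
open import Relation.Nullary using (¬_; Dec; yes; no; ¬?; _×-dec_; _⊎-dec_; contradiction)
open import Relation.Nullary.Decidable using (decidable-stable; dec-true; dec-false)
open import Defs

-- Cardinalities of finite subsets, and indexing into lists.

x∈p─q⇒x∉q : ∀ {n} (p q : Subset n) {x} → x ∈ p ─ q → x ∉ q
x∈p─q⇒x∉q (_ ∷ p) (inside ∷ q) (there x∈) (there x∈q) = x∈p─q⇒x∉q p q x∈ x∈q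
x∈p─q⇒x∉q (_ ∷ p) (outside ∷ q) (there x∈) (there x∈q) = x∈p─q⇒x∉q p q x∈ x∈q

x∈p-y⇒x∈p : ∀ {n} (p : Subset n) {x y} → x ∈ p - y → x ∈ p
x∈p-y⇒x∈p p {y = y} = p─q⊆p p ⁅ y ⁆

x∈p-y⇒x≢y : ∀ {n} (p : Subset n) {x y} → x ∈ p - y → x ≢ y
x∈p-y⇒x≢y p {y = y} x∈ = x∉⁅y⁆⇒x≢y (x∈p─q⇒x∉q p ⁅ y ⁆ x∈)

∣p∣≤1+∣p-x∣ : ∀ {n} (p : Subset n) x → ∣ p ∣ ≤ suc ∣ p - x ∣
∣p∣≤1+∣p-x∣ (inside  ∷ p) zero    = s≤s (ℕ.≤-reflexive (cong ∣_∣ (sym (p─⊥≡p p))))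
∣p∣≤1+∣p-x∣ (outside ∷ p) zero    = ℕ.m≤n⇒m≤1+n (ℕ.≤-reflexive (cong ∣_∣ (sym (p─⊥≡p p))))
∣p∣≤1+∣p-x∣ (inside  ∷ p) (suc x) = s≤s (∣p∣≤1+∣p-x∣ p x)
∣p∣≤1+∣p-x∣ (outside ∷ p) (suc x) = ∣p∣≤1+∣p-x∣ p x

∣⁅a⁆∪⁅b⁆∣≡2 : ∀ {n} {a b : Fin n} → a ≢ b → ∣ ⁅ a ⁆ ∪ ⁅ b ⁆ ∣ ≡ 2
∣⁅a⁆∪⁅b⁆∣≡2 {a = zero}  {zero}  a≢b = contradiction refl a≢b
∣⁅a⁆∪⁅b⁆∣≡2 {a = zero}  {suc b} a≢b = cong suc (trans (cong ∣_∣ (∪-identityˡ ⁅ b ⁆)) (∣⁅x⁆∣≡1 b))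
∣⁅a⁆∪⁅b⁆∣≡2 {a = suc a} {zero}  a≢b = cong suc (trans (cong ∣_∣ (∪-identityʳ ⁅ a ⁆)) (∣⁅x⁆∣≡1 a))
∣⁅a⁆∪⁅b⁆∣≡2 {a = suc a} {suc b} a≢b = ∣⁅a⁆∪⁅b⁆∣≡2 (a≢b ∘ cong suc)

∣p∣>0⇒Nonempty : ∀ {n} (p : Subset n) → 0 < ∣ p ∣ → Nonempty p
∣p∣>0⇒Nonempty {n} p 0<∣p∣ = decidable-stable (nonempty? p) λ empty →
  ℕ.<⇒≢ 0<∣p∣ (sym (trans (cong ∣_∣ (Empty-unique empty)) (∣⊥∣≡0 n)))

x∈p⇒∣p∣>0 : ∀ {n} {p : Subset n} {x} → x ∈ p → 0 < ∣ p ∣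
x∈p⇒∣p∣>0 x∈ = ℕ.≤-<-trans z≤n (x∈p⇒∣p-x∣<∣p∣ x∈)

-- A cutset of at most two vertices may have fewer than two, while a separation needs two distinct
-- ones; the missing ones are drawn from `p`.
enclose-in-pair : ∀ {n} (p q : Subset n) → q ⊆ p → ∣ q ∣ < 3 → 1 < ∣ p ∣ →
  ∃₂ λ u v → u ≢ v × u ∈ p × v ∈ p × (∀ {i} → i ∈ q → i ≡ u ⊎ i ≡ v)
enclose-in-pair {n} p q q⊆p ∣q∣<3 1<∣p∣ = go (nonempty? q)
  where
  Goal : Set
  Goal = ∃₂ λ u v → u ≢ v × u ∈ p × v ∈ p × (∀ {i} → i ∈ q → i ≡ u ⊎ i ≡ v)

  another : ∀ u → ∃[ v ] v ∈ p - u
  another u = ∣p∣>0⇒Nonempty (p - u) (s≤s⁻¹ (ℕ.≤-trans 1<∣p∣ (∣p∣≤1+∣p-x∣ p u)))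

  complete : ∀ u → u ∈ p → (∀ {i} → i ∈ q → i ≡ u) → Goal
  complete u u∈ q⊆u = let v , v∈ = another u in
    u , v , ≢-sym (x∈p-y⇒x≢y p v∈) , u∈ , x∈p-y⇒x∈p p v∈ , inj₁ ∘ q⊆u

  go : Dec (Nonempty q) → Goal
  go (no empty) = let u , u∈ = ∣p∣>0⇒Nonempty p (ℕ.<-trans (s≤s z≤n) 1<∣p∣) in
    complete u u∈ λ i∈ → contradiction (_ , i∈) empty
  go (yes (u , u∈)) with nonempty? (q - u)
  ... | no empty = complete u (q⊆p u∈) λ {i} i∈ →
    decidable-stable (i Fin.≟ u) λ i≢u → empty (i , x∈p∧x≢y⇒x∈p-y i∈ i≢u)
  ... | yes (v , v∈) =
    u , v , ≢-sym (x∈p-y⇒x≢y q v∈) , q⊆p u∈ , q⊆p (x∈p-y⇒x∈p q v∈) , pair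
    where
    pair : ∀ {i} → i ∈ q → i ≡ u ⊎ i ≡ v
    pair {i} i∈ with i Fin.≟ u | i Fin.≟ v
    ... | yes i≡u | _ = inj₁ i≡u
    ... | _ | yes i≡v = inj₂ i≡v
    ... | no i≢u | no i≢v = contradiction ∣q∣<3 (ℕ.≤⇒≯
      (ℕ.≤-trans (s≤s (ℕ.≤-trans (s≤s (x∈p⇒∣p∣>0 (x∈p∧x≢y⇒x∈p-y (x∈p∧x≢y⇒x∈p-y i∈ i≢u) i≢v)))
        (x∈p⇒∣p-x∣<∣p∣ v∈))) (x∈p⇒∣p-x∣<∣p∣ u∈)))

-- The number of colours is a successor so that elements outside `p` have a default colour.
injective-colouring : ∀ {n} (p : Subset n) {k} → ∣ p ∣ ≤ suc k →
  Σ (Fin n → Fin (suc k)) λ c → ∀ {i j} → i ∈ p → j ∈ p → c i ≡ c j → i ≡ j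
injective-colouring []            _ = const zero , λ ()
injective-colouring (outside ∷ p) {k} ∣p∣≤ =
  let c , inj = injective-colouring p ∣p∣≤
  in (λ { zero → zero ; (suc i) → c i }) , λ { (there i∈) (there j∈) → cong suc ∘ inj i∈ j∈ }
injective-colouring (inside ∷ p) {zero} (s≤s ∣p∣≤0) = const zero , λ where
  here       here       _ → refl
  (there i∈) _          _ → contradiction ∣p∣≤0 (ℕ.<⇒≱ (x∈p⇒∣p∣>0 i∈))
  _          (there j∈) _ → contradiction ∣p∣≤0 (ℕ.<⇒≱ (x∈p⇒∣p∣>0 j∈))
injective-colouring (inside ∷ p) {suc k} (s≤s ∣p∣≤) =
  let c , inj = injective-colouring p ∣p∣≤
  in (λ { zero → zero ; (suc i) → suc (c i) }) , λ where
       here       here       _  → refl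
       (there i∈) (there j∈) eq → cong suc (inj i∈ j∈ (Fin.suc-injective eq))

AllPairs-lookup : ∀ {A : Set} {R : A → A → Set} → Symmetric R → ∀ {xs} → AllPairs R xs →
  ∀ {i j} → i ≢ j → R (lookup xs i) (lookup xs j)
AllPairs-lookup R-sym (_ ∷ _)  {zero}  {zero}  i≢j = contradiction refl i≢j
AllPairs-lookup R-sym (r ∷ _)  {zero}  {suc j} _   = All.lookup r (∈-lookup j)
AllPairs-lookup R-sym (r ∷ _)  {suc i} {zero}  _   = R-sym (All.lookup r (∈-lookup i))
AllPairs-lookup R-sym (_ ∷ rs) {suc i} {suc j} i≢j = AllPairs-lookup R-sym rs (i≢j ∘ cong suc)

module _ {m : ℕ} where

  fresh? : (l : List (Fin m)) → Dec (∃[ δ ] All (δ ≢_) l)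
  fresh? l = Fin.any? λ δ → All.all? (λ a → ¬? (δ Fin.≟ a)) l

  -- If every colour occurred in `l`, choosing positions would map `m` colours into fewer places,
  -- and two colours would share a position.
  fresh : (l : List (Fin m)) → length l < m → ∃[ δ ] All (δ ≢_) l
  fresh l l<m = decidable-stable (fresh? l) λ none →
    let occurs : ∀ δ → Any (δ ≡_) l
        occurs δ = Any.map (decidable-stable (δ Fin.≟ _))
                     (¬All⇒Any¬ (λ a → ¬? (δ Fin.≟ a)) l λ δ∉ → none (δ , δ∉))
        i , j , i<j , eq = Fin.pigeonhole l<m λ δ → Any.index (occurs δ)
    in Fin.<⇒≢ i<j (trans (lookup-index (occurs i))
         (trans (cong (lookup l) eq) (sym (lookup-index (occurs j)))))

  fresh₃ : 3 < m → ∀ a b c → ∃[ δ ] δ ≢ a × δ ≢ b × δ ≢ c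
  fresh₃ 3<m a b c with δ , p ∷ q ∷ r ∷ [] ← fresh (a ∷ b ∷ c ∷ []) 3<m = δ , p , q , r

  -- A coincidence among the four leaves at most three colours in use, and a fourth colour would
  -- then avoid them all.
  rainbow : 3 < m → ∀ {a b c d} → ¬ (∃[ δ ] All (δ ≢_) (a ∷ b ∷ c ∷ d ∷ [])) →
            AllPairs _≢_ (a ∷ b ∷ c ∷ d ∷ [])
  rainbow 3<m {a} {b} {c} {d} none =
    (ab ∷ ac ∷ ad ∷ []) ∷ (bc ∷ bd ∷ []) ∷ (cd ∷ []) ∷ [] ∷ []
    where
    ab : a ≢ b
    ab refl = let δ , p , q , r = fresh₃ 3<m a c d in none (δ , p ∷ p ∷ q ∷ r ∷ [])
    ac : a ≢ c
    ac refl = let δ , p , q , r = fresh₃ 3<m a b d in none (δ , p ∷ q ∷ p ∷ r ∷ [])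
    ad : a ≢ d
    ad refl = let δ , p , q , r = fresh₃ 3<m a b c in none (δ , p ∷ q ∷ r ∷ p ∷ [])
    bc : b ≢ c
    bc refl = let δ , p , q , r = fresh₃ 3<m a b d in none (δ , p ∷ q ∷ q ∷ r ∷ [])
    bd : b ≢ d
    bd refl = let δ , p , q , r = fresh₃ 3<m a b c in none (δ , p ∷ q ∷ r ∷ q ∷ [])
    cd : c ≢ d
    cd refl = let δ , p , q , r = fresh₃ 3<m a b c in none (δ , p ∷ q ∷ r ∷ r ∷ [])

  transpose-fst : (a b : Fin m) → transpose a b ⟨$⟩ʳ a ≡ b
  transpose-fst a b rewrite dec-true (a Fin.≟ a) refl = refl

  transpose-other : ∀ {a b i : Fin m} → i ≢ a → i ≢ b → transpose a b ⟨$⟩ʳ i ≡ i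
  transpose-other {a} {b} {i} i≢a i≢b
    rewrite dec-false (i Fin.≟ a) i≢a | dec-false (i Fin.≟ b) i≢b = refl

  permutation-injective : (σ : Permutation′ m) → ∀ {a b} → σ ⟨$⟩ʳ a ≡ σ ⟨$⟩ʳ b → a ≡ b
  permutation-injective σ {a} {b} eq =
    trans (sym (Inverse.strictlyInverseʳ σ a))
      (trans (cong (Inverse.from σ) eq) (Inverse.strictlyInverseʳ σ b))

  infix 4 _∼_
  -- Exactly what a permutation sending `a` to `α` and `b` to `β` requires: it has to preserve both
  -- equality and inequality.
  _∼_ : Fin m × Fin m → Fin m × Fin m → Set
  (a , b) ∼ (α , β) = (a ≡ b × α ≡ β) ⊎ (a ≢ b × α ≢ β)

  pattern same p q = inj₁ (p , q)
  pattern diff p q = inj₂ (p , q)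

  ∼-comm : ∀ {a b α β} → (a , b) ∼ (α , β) → (b , a) ∼ (β , α)
  ∼-comm (same p q) = same (sym p) (sym q)
  ∼-comm (diff p q) = diff (≢-sym p) (≢-sym q)

  -- A partial assignment of colours that preserves equality and inequality is a partial injection,
  -- hence extends to a permutation. It is built with one transposition per entry.
  prescribe : (ts : List (Fin m × Fin m)) →
    AllPairs (λ (a , α) (b , β) → (a , b) ∼ (α , β)) ts →
    ∃[ σ ] All (λ (a , α) → σ ⟨$⟩ʳ a ≡ α) ts
  prescribe [] [] = idₚ , []
  prescribe ((a , α) ∷ ts) (a∼ts ∷ ts∼) =
    let σ , σ-ok = prescribe ts ts∼
        -- The transposition moves the current image of `a` to `α`. An entry with a different source
        -- and target stays put, its image being neither of the two swapped colours.
        τ = transpose (σ ⟨$⟩ʳ a) α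
        keep : ∀ {t} → (a , proj₁ t) ∼ (α , proj₂ t) → σ ⟨$⟩ʳ proj₁ t ≡ proj₂ t →
               τ ⟨$⟩ʳ (σ ⟨$⟩ʳ proj₁ t) ≡ proj₂ t
        keep = λ where
          (same refl refl) _ → transpose-fst (σ ⟨$⟩ʳ a) α
          (diff a≢b α≢β) refl →
            transpose-other (a≢b ∘ sym ∘ permutation-injective σ) (≢-sym α≢β)
    in σ ∘ₚ τ , transpose-fst (σ ⟨$⟩ʳ a) α ∷ All.zipWith (λ (p , q) → keep p q) (a∼ts , σ-ok)

  Two : Fin m → Fin m → Fin m → Set
  Two a b c = (a ≡ b × a ≢ c) ⊎ (a ≡ c × a ≢ b) ⊎ (b ≡ c × a ≢ b)

  pattern two₁₂ p q = inj₁ (p , q)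
  pattern two₁₃ p q = inj₂ (inj₁ (p , q))
  pattern two₂₃ p q = inj₂ (inj₂ (p , q))

  Two-swap₁₂ : ∀ {a b c} → Two a b c → Two b a c
  Two-swap₁₂ (two₁₂ refl q) = two₁₂ refl q
  Two-swap₁₂ (two₁₃ refl q) = two₂₃ refl (≢-sym q)
  Two-swap₁₂ (two₂₃ refl q) = two₁₃ refl (≢-sym q)

  Two-swap₂₃ : ∀ {a b c} → Two a b c → Two a c b
  Two-swap₂₃ (two₁₂ p q) = two₁₃ p q
  Two-swap₂₃ (two₁₃ p q) = two₁₂ p q
  Two-swap₂₃ (two₂₃ refl q) = two₂₃ refl q

  Two-resp : ∀ {a b c a′ b′ c′} → a′ ≡ a → b′ ≡ b → c′ ≡ c → Two a b c → Two a′ b′ c′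
  Two-resp refl refl refl t = t

  Two-fresh : 3 < m → ∀ {a b c} → Two a b c → ∀ d → ∃[ δ ] δ ≢ a × δ ≢ b × δ ≢ c × δ ≢ d
  Two-fresh 3<m {a} {b} {c} (two₁₂ refl _) d =
    let δ , p , q , r = fresh₃ 3<m a c d in δ , p , p , q , r
  Two-fresh 3<m {a} {b} {c} (two₁₃ refl _) d =
    let δ , p , q , r = fresh₃ 3<m a b d in δ , p , q , p , r
  Two-fresh 3<m {a} {b} {c} (two₂₃ refl _) d =
    let δ , p , q , r = fresh₃ 3<m a b d in δ , p , q , q , r

  Two⇒∣∣≡2 : ∀ {a b c} → Two a b c → ∣ ⁅ a ⁆ ∪ ⁅ b ⁆ ∪ ⁅ c ⁆ ∣ ≡ 2
  Two⇒∣∣≡2 {a} {b} {c} (two₁₂ refl a≢c) =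
    trans (cong ∣_∣ (trans (sym (∪-assoc ⁅ a ⁆ ⁅ a ⁆ ⁅ c ⁆)) (cong (_∪ ⁅ c ⁆) (∪-idem ⁅ a ⁆))))
      (∣⁅a⁆∪⁅b⁆∣≡2 a≢c)
  Two⇒∣∣≡2 {a} {b} (two₁₃ refl a≢b) =
    trans (cong (λ p → ∣ ⁅ a ⁆ ∪ p ∣) (∪-comm ⁅ b ⁆ ⁅ a ⁆)) (Two⇒∣∣≡2 (two₁₂ refl a≢b))
  Two⇒∣∣≡2 {a} {b} (two₂₃ refl a≢b) =
    trans (cong (λ p → ∣ ⁅ a ⁆ ∪ p ∣) (∪-idem ⁅ b ⁆)) (∣⁅a⁆∪⁅b⁆∣≡2 a≢b)

-- Colourings on vertex sets, and separations of order two.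

module Colourings {n : ℕ} (G : Graph n) (k : ℕ) where

  Colour : Set
  Colour = Fin (4 + k)

  3<colours : 3 < 4 + k
  3<colours = s≤s (s≤s (s≤s (s≤s z≤n)))

  private variable
    S : Subset n
    a b i w x y z : Fin n

  Proper : {m : ℕ} → Subset n → (Fin n → Fin m) → Set
  Proper S c = ∀ {a b} → a ∈ S → b ∈ S → E G a b → c a ≢ c b

  Triangle : Fin n → Fin n → Fin n → Set
  Triangle x y z = E G x y × E G x z × E G y z

  triangle? : ∀ x y z → Dec (Triangle x y z)
  triangle? x y z = E-dec G x y ×-dec E-dec G x z ×-dec E-dec G y z

  -- A clique is an indexed family, automatically injective because no vertex is adjacent to itself.
  -- With `4 + k` in the role of m, the bound m - 1 is `3 + k`.
  CliquesFit : Subset n → Set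
  CliquesFit S = ∀ {r} (q : Fin r → Fin n) → (∀ i → q i ∈ S) →
    (∀ {i j} → i ≢ j → E G (q i) (q j)) → r ≤ 3 + k

  -- Since apart allows y ≡ z, it covers both (2) and (3) of the theorem.
  record Flexible (S : Subset n) : Set where
    field
      equal : x ∈ S → y ∈ S → ¬ E G x y → ∃[ c ] Proper {4 + k} S c × c x ≡ c y
      apart : x ∈ S → y ∈ S → z ∈ S → x ≢ y → x ≢ z →
              ∃[ c ] Proper {4 + k} S c × c x ≢ c y × c x ≢ c z
      two   : x ∈ S → y ∈ S → z ∈ S → x ≢ y → x ≢ z → y ≢ z → ¬ Triangle x y z →
              ∃[ c ] Proper {4 + k} S c × Two (c x) (c y) (c z)

    apart₂ : x ∈ S → y ∈ S → x ≢ y → ∃[ c ] Proper {4 + k} S c × c x ≢ c y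
    apart₂ x∈ y∈ x≢y with c , c-ok , p , _ ← apart x∈ y∈ y∈ x≢y x≢y = c , c-ok , p

  -- Two sides overlapping exactly in `u` and `v`, with no edge between their remainders. Strict
  -- inclusion in `S` is what the induction descends on.
  record Separation (S : Subset n) : Set where
    field
      {u v}     : Fin n
      {S₁ S₂}   : Subset n
      u≢v       : u ≢ v
      u∈₁       : u ∈ S₁
      u∈₂       : u ∈ S₂
      v∈₁       : v ∈ S₁
      v∈₂       : v ∈ S₂
      S₁⊂S      : S₁ ⊂ S
      S₂⊂S      : S₂ ⊂ S
      cover     : i ∈ S → i ∈ S₁ ⊎ i ∈ S₂
      meet      : i ∈ S₁ → i ∈ S₂ → i ≡ u ⊎ i ≡ v
      edge      : a ∈ S → b ∈ S → E G a b → (a ∈ S₁ × b ∈ S₁) ⊎ (a ∈ S₂ × b ∈ S₂)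

  -- Together with `flip-cut`, this lets later lemmas treat a single choice of side and of cut
  -- vertex.
  flip-sides : Separation S → Separation S
  flip-sides sep = record
    { u≢v = u≢v ; u∈₁ = u∈₂ ; u∈₂ = u∈₁ ; v∈₁ = v∈₂ ; v∈₂ = v∈₁
    ; S₁⊂S = S₂⊂S ; S₂⊂S = S₁⊂S
    ; cover = λ p → Sum.swap (cover p)
    ; meet = λ p q → meet q p
    ; edge = λ p q e → Sum.swap (edge p q e) }
    where open Separation sep

  flip-cut : Separation S → Separation S
  flip-cut sep = record
    { u≢v = ≢-sym u≢v ; u∈₁ = v∈₁ ; u∈₂ = v∈₂ ; v∈₁ = u∈₁ ; v∈₂ = u∈₂
    ; S₁⊂S = S₁⊂S ; S₂⊂S = S₂⊂S ; cover = cover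
    ; meet = λ p q → Sum.swap (meet p q)
    ; edge = edge }
    where open Separation sep

  -- Gluing two colourings along the cut.

  recolour : {c : Fin n → Colour} → Proper S c → (σ : Permutation′ (4 + k)) →
             Proper S (λ i → σ ⟨$⟩ʳ c i)
  recolour c-ok σ a∈ b∈ e = c-ok a∈ b∈ e ∘ permutation-injective σ

  module Gluing (sep : Separation S) where
    open Separation sep

    glue : {c₁ c₂ : Fin n → Colour} → Proper S₁ c₁ → Proper S₂ c₂ → c₂ u ≡ c₁ u → c₂ v ≡ c₁ v →
           ∃[ c ] Proper S c × (∀ {i} → i ∈ S₁ → c i ≡ c₁ i) × (∀ {i} → i ∈ S₂ → c i ≡ c₂ i)
    glue {c₁} {c₂} ok₁ ok₂ u-eq v-eq = (λ i → choose i (i ∈? S₁)) , ok , on₁ , on₂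
      where
      choose : ∀ i → Dec (i ∈ S₁) → Colour
      choose i (yes _) = c₁ i
      choose i (no _)  = c₂ i

      on₁ : i ∈ S₁ → choose i (i ∈? S₁) ≡ c₁ i
      on₁ {i} i∈ with i ∈? S₁
      ... | yes _  = refl
      ... | no i∉  = contradiction i∈ i∉

      on₂ : i ∈ S₂ → choose i (i ∈? S₁) ≡ c₂ i
      on₂ {i} i∈ with i ∈? S₁
      ... | no _   = refl
      ... | yes i∈₁ with meet i∈₁ i∈
      ...   | inj₁ refl = sym u-eq
      ...   | inj₂ refl = sym v-eq

      ok : Proper S (λ i → choose i (i ∈? S₁))
      ok a∈ b∈ e eq with edge a∈ b∈ e
      ... | inj₁ (a∈₁ , b∈₁) = ok₁ a∈₁ b∈₁ e (trans (sym (on₁ a∈₁)) (trans eq (on₁ b∈₁)))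
      ... | inj₂ (a∈₂ , b∈₂) = ok₂ a∈₂ b∈₂ e (trans (sym (on₂ a∈₂)) (trans eq (on₂ b∈₂)))

    Extends : (Fin n → Colour) → Fin n → Colour → Set
    Extends c₁ w γ = ∃[ c ] Proper S c × (∀ {i} → i ∈ S₁ → c i ≡ c₁ i) × c w ≡ γ

    -- Only the equalities among the colours of `u`, `v`, `w` have to match: a permutation of the
    -- colours of `c₂` then realises the exact targets `c₁ u`, `c₁ v`, `γ`.
    extend : {c₁ c₂ : Fin n → Colour} {γ : Colour} → Proper S₁ c₁ → Proper S₂ c₂ → w ∈ S₂ →
      (c₂ u , c₂ v) ∼ (c₁ u , c₁ v) → (c₂ u , c₂ w) ∼ (c₁ u , γ) → (c₂ v , c₂ w) ∼ (c₁ v , γ) →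
      Extends c₁ w γ
    extend {w} {c₁} {c₂} {γ} ok₁ ok₂ w∈ uv uw vw
      with σ , u-eq ∷ v-eq ∷ w-eq ∷ [] ← prescribe
             ((c₂ u , c₁ u) ∷ (c₂ v , c₁ v) ∷ (c₂ w , γ) ∷ [])
             ((uv ∷ uw ∷ []) ∷ (vw ∷ []) ∷ [] ∷ [])
      with c , ok , on₁ , on₂ ← glue ok₁ (recolour ok₂ σ) u-eq v-eq
      = c , ok , on₁ , trans (on₂ w∈) w-eq

    module _ (F₁ : Flexible S₁) (F₂ : Flexible S₂) where
      private
        module F₁ = Flexible F₁
        module F₂ = Flexible F₂

      match : {c₁ : Fin n → Colour} → Proper S₁ c₁ →
              ∃[ c₂ ] Proper S₂ c₂ × (c₂ u , c₂ v) ∼ (c₁ u , c₁ v)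
      match {c₁} ok₁ with c₁ u Fin.≟ c₁ v
      ... | yes p with c₂ , ok₂ , q ← F₂.equal u∈₂ v∈₂ (λ e → ok₁ u∈₁ v∈₁ e p) =
        c₂ , ok₂ , same q p
      ... | no p with c₂ , ok₂ , q ← F₂.apart₂ u∈₂ v∈₂ u≢v = c₂ , ok₂ , diff q p

      extend₁ : {c₁ : Fin n → Colour} → Proper S₁ c₁ →
                ∃[ c ] Proper S c × (∀ {i} → i ∈ S₁ → c i ≡ c₁ i)
      extend₁ ok₁ =
        let c₂ , ok₂ , uv = match ok₁
            c , ok , on₁ , _ = extend ok₁ ok₂ u∈₂ uv (same refl refl) (∼-comm uv)
        in c , ok , on₁

      equal₁ : x ∈ S₁ → y ∈ S₁ → ¬ E G x y → ∃[ c ] Proper S c × c x ≡ c y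
      equal₁ x∈ y∈ ¬e =
        let c₁ , ok₁ , p = F₁.equal x∈ y∈ ¬e
            c , ok , on₁ = extend₁ ok₁
        in c , ok , trans (on₁ x∈) (trans p (sym (on₁ y∈)))

      apart₁ : x ∈ S₁ → y ∈ S₁ → z ∈ S₁ → x ≢ y → x ≢ z →
               ∃[ c ] Proper S c × c x ≢ c y × c x ≢ c z
      apart₁ x∈ y∈ z∈ x≢y x≢z =
        let c₁ , ok₁ , p , q = F₁.apart x∈ y∈ z∈ x≢y x≢z
            c , ok , on₁ = extend₁ ok₁
        in c , ok
         , (λ eq → p (trans (sym (on₁ x∈)) (trans eq (on₁ y∈))))
         , (λ eq → q (trans (sym (on₁ x∈)) (trans eq (on₁ z∈))))

      two₁ : x ∈ S₁ → y ∈ S₁ → z ∈ S₁ → x ≢ y → x ≢ z → y ≢ z → ¬ Triangle x y z →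
             ∃[ c ] Proper S c × Two (c x) (c y) (c z)
      two₁ {x} {y} {z} x∈ y∈ z∈ x≢y x≢z y≢z ¬t =
        let c₁ , ok₁ , t = F₁.two x∈ y∈ z∈ x≢y x≢z y≢z ¬t
            c , ok , on₁ = extend₁ ok₁
        in c , ok , Two-resp (on₁ x∈) (on₁ y∈) (on₁ z∈) t

      -- The colours of u, v and a vertex w off the cut form one of the patterns
      --   B: u = v ≠ w,   C: w = u ≠ v,   D: w = v ≠ u,   E: all distinct.
      -- Here x shows B and y shows E; x also shows E or both C and D, and y also shows one of
      -- B, C, D, so the two sides share a pattern.
      equal-BE : {c₁ c₂ : Fin n → Colour} → x ∈ S₁ → y ∈ S₂ → x ∉ S₂ → y ∉ S₁ →
        Proper S₁ c₁ → c₁ u ≡ c₁ v → c₁ x ≢ c₁ u → c₁ x ≢ c₁ v →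
        Proper S₂ c₂ → c₂ u ≢ c₂ v → c₂ y ≢ c₂ u → c₂ y ≢ c₂ v →
        ∃[ c ] Proper S c × c x ≡ c y
      equal-BE {x} {y} {c₁} {c₂} x∈ y∈ x∉ y∉ ok₁ uv₁ xu₁ xv₁ ok₂ uv₂ yu₂ yv₂ = result
        where
        u≢x : u ≢ x
        u≢x refl = x∉ u∈₂
        v≢x : v ≢ x
        v≢x refl = x∉ v∈₂
        u≢y : u ≢ y
        u≢y refl = y∉ u∈₁
        v≢y : v ≢ y
        v≢y refl = y∉ v∈₁

        Goal : Set
        Goal = ∃[ c ] Proper S c × c x ≡ c y

        join : {c c′ : Fin n → Colour} → Proper S₁ c → Proper S₂ c′ →
          (c′ u , c′ v) ∼ (c u , c v) → (c′ u , c′ y) ∼ (c u , c x) →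
          (c′ v , c′ y) ∼ (c v , c x) → Goal
        join ok ok′ p q r with d , d-ok , on₁ , d-y ← extend ok ok′ y∈ p q r =
          d , d-ok , trans (on₁ x∈) (sym d-y)

        -- A colouring of one side with `u` and `v` equal rules out the edge, so on the other side
        -- `u`, `v`, `y` is no triangle.
        ¬uv : ¬ E G u v
        ¬uv e = ok₁ u∈₁ v∈₁ e uv₁

        result : Goal
        result with c , c-ok , vu , vx ← F₁.apart v∈₁ u∈₁ x∈ (≢-sym u≢v) v≢x
               | c u Fin.≟ c x
        ... | no ux = join c-ok ok₂ (diff uv₂ (≢-sym vu)) (diff (≢-sym yu₂) ux) (diff (≢-sym yv₂) vx)
        ... | yes ux with d , d-ok , uv , ux′ ← F₁.apart u∈₁ v∈₁ x∈ u≢v u≢x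
               | d v Fin.≟ d x
        ...   | no vx′ = join d-ok ok₂ (diff uv₂ uv) (diff (≢-sym yu₂) ux′) (diff (≢-sym yv₂) vx′)
        ...   | yes vx′ with F₂.two u∈₂ v∈₂ y∈ u≢v u≢y v≢y (¬uv ∘ proj₁)
        ...     | c′ , ok′ , two₁₂ p q =
                    join ok₁ ok′ (same p uv₁) (diff q (≢-sym xu₁)) (diff (q ∘ trans p) (≢-sym xv₁))
        ...     | c′ , ok′ , two₁₃ p q =
                    join c-ok ok′ (diff q (≢-sym vu)) (same p ux) (diff (λ r → q (trans p (sym r))) vx)
        ...     | c′ , ok′ , two₂₃ p q =
                    join d-ok ok′ (diff q uv) (diff (λ r → q (trans r (sym p))) ux′) (same p vx′)

      -- The last two hypotheses forbid `z` to copy a cut vertex coloured `δ`. If `z` shares the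
      -- colour of `u` or `v` in `c₂`, its new colour is forced and differs from `δ`; otherwise any
      -- colour other than `δ` and those of the cut will do.
      extend-avoiding : {c₁ c₂ : Fin n → Colour} → Proper S₁ c₁ → Proper S₂ c₂ → z ∈ S₂ →
        (c₂ u , c₂ v) ∼ (c₁ u , c₁ v) → ∀ δ →
        (δ ≡ c₁ u → c₂ z ≢ c₂ u) → (δ ≡ c₁ v → c₂ z ≢ c₂ v) →
        ∃[ γ ] γ ≢ δ × Extends c₁ z γ
      extend-avoiding {z} {c₁} {c₂} ok₁ ok₂ z∈ uv δ δu δv with c₂ z Fin.≟ c₂ u
      ... | yes zu = c₁ u , (λ p → δu (sym p) zu)
                   , extend ok₁ ok₂ z∈ uv (same (sym zu) refl)
                       (subst (λ a → (c₂ v , a) ∼ (c₁ v , c₁ u)) (sym zu) (∼-comm uv))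
      ... | no z≢u with c₂ z Fin.≟ c₂ v
      ...   | yes zv = c₁ v , (λ p → δv (sym p) zv)
                     , extend ok₁ ok₂ z∈ uv
                         (subst (λ a → (c₂ u , a) ∼ (c₁ u , c₁ v)) (sym zv) uv)
                         (same (sym zv) refl)
      ...   | no z≢v =
                let γ , γu , γv , γδ = fresh₃ 3<colours (c₁ u) (c₁ v) δ
                in γ , γδ , extend ok₁ ok₂ z∈ uv
                     (diff (≢-sym z≢u) (≢-sym γu)) (diff (≢-sym z≢v) (≢-sym γv))

      ∉₂⇒≢ : x ∉ S₂ → w ∈ S₂ → x ≢ w
      ∉₂⇒≢ x∉ w∈ refl = x∉ w∈

      ∉₁⇒≢ : x ∉ S₁ → w ∈ S₁ → x ≢ w
      ∉₁⇒≢ x∉ w∈ refl = x∉ w∈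

      apart-at-cut : y ∈ S₁ → z ∈ S₂ → u ≢ y → u ≢ z → ∃[ c ] Proper S c × c u ≢ c y × c u ≢ c z
      apart-at-cut y∈ z∈ u≢y u≢z =
        let c₁ , ok₁ , uy , uv₁ = F₁.apart u∈₁ y∈ v∈₁ u≢y u≢v
            c₂ , ok₂ , uz , uv₂ = F₂.apart u∈₂ z∈ v∈₂ u≢z u≢v
            γ , γ≢ , c , ok , on₁ , c-z = extend-avoiding ok₁ ok₂ z∈ (diff uv₂ uv₁) (c₁ u)
              (λ _ → ≢-sym uz) (λ p → contradiction p uv₁)
        in c , ok
         , (λ p → uy (trans (sym (on₁ u∈₁)) (trans p (on₁ y∈))))
         , (λ p → γ≢ (trans (sym c-z) (trans (sym p) (on₁ u∈₁))))

      -- `c₁` keeps `x` apart from `u`, so the only cut vertex that can share its colour is `v`. In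
      -- that case the other side is coloured with `v` apart from `u` and `z`, and `z` cannot
      -- inherit that colour.
      apart-off-cut : x ∈ S₁ → x ∉ S₂ → y ∈ S₁ → z ∈ S₂ → z ∉ S₁ → x ≢ y →
        ∃[ c ] Proper S c × c x ≢ c y × c x ≢ c z
      apart-off-cut {x} {y} {z} x∈ x∉ y∈ z∈ z∉ x≢y
        with c₁ , ok₁ , xy , xu ← F₁.apart x∈ y∈ u∈₁ x≢y (∉₂⇒≢ x∉ u∈₂) = result
        where
        finish : ∃[ γ ] γ ≢ c₁ x × Extends c₁ z γ → ∃[ c ] Proper S c × c x ≢ c y × c x ≢ c z
        finish (γ , γ≢ , c , ok , on₁ , c-z) = c , ok
          , (λ p → xy (trans (sym (on₁ x∈)) (trans p (on₁ y∈))))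
          , (λ p → γ≢ (trans (sym c-z) (trans (sym p) (on₁ x∈))))

        result : ∃[ c ] Proper S c × c x ≢ c y × c x ≢ c z
        result with c₁ x Fin.≟ c₁ v
        ... | yes xv =
          let c₂ , ok₂ , vu , vz = F₂.apart v∈₂ u∈₂ z∈ (≢-sym u≢v) (≢-sym (∉₁⇒≢ z∉ v∈₁))
          in finish (extend-avoiding ok₁ ok₂ z∈ (diff (≢-sym vu) (λ p → xu (trans xv (sym p)))) (c₁ x)
               (λ p → contradiction p xu) (λ _ → ≢-sym vz))
        ... | no xv =
          let c₂ , ok₂ , uv = match ok₁
          in finish (extend-avoiding ok₁ ok₂ z∈ uv (c₁ x)
               (λ p → contradiction p xu) (λ p → contradiction p xv))

      -- Under pattern B the cut shows one colour, so `x` has at most three colours to avoid. Under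
      -- pattern E a colour outside those of `u`, `v`, `y`, `z` is wanted, which can be missing only
      -- if these four differ and m is 4.
      apart-opposite : CliquesFit S₁ → x ∈ S₂ → x ∉ S₁ → y ∈ S₁ → z ∈ S₁ →
        ∃[ c ] Proper S c × c x ≢ c y × c x ≢ c z
      apart-opposite {x} {y} {z} fit x∈ x∉ y∈ z∈ = result
        where
        Goal : Set
        Goal = ∃[ c ] Proper S c × c x ≢ c y × c x ≢ c z

        finish : ∀ {c₁ γ} → Extends c₁ x γ → γ ≢ c₁ y → γ ≢ c₁ z → Goal
        finish (c , ok , on₁ , c-x) γy γz = c , ok
          , (λ p → γy (trans (sym c-x) (trans p (on₁ y∈))))
          , (λ p → γz (trans (sym c-x) (trans p (on₁ z∈))))

        use-B : ∀ {c₂} → Proper S₂ c₂ → c₂ u ≡ c₂ v → c₂ u ≢ c₂ x → Goal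
        use-B ok₂ uv ux =
          let c₁ , ok₁ , uv₁ = F₁.equal u∈₁ v∈₁ (λ e → ok₂ u∈₂ v∈₂ e uv)
              γ , γu , γy , γz = fresh₃ 3<colours (c₁ u) (c₁ y) (c₁ z)
          in finish (extend ok₁ ok₂ x∈ (same uv uv₁) (diff ux (≢-sym γu))
                   (diff (ux ∘ trans uv) (≢-sym (γu ∘ (λ p → trans p (sym uv₁)))))) γy γz

        module _ {c₂ : Fin n → Colour} (ok₂ : Proper S₂ c₂)
                 (xu : c₂ x ≢ c₂ u) (xv : c₂ x ≢ c₂ v) (uv : c₂ u ≢ c₂ v) where

          use-E : ∀ {c₁ δ} → Proper S₁ c₁ → c₁ u ≢ c₁ v →
                  δ ≢ c₁ u → δ ≢ c₁ v → δ ≢ c₁ y → δ ≢ c₁ z → Goal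
          use-E ok₁ uv₁ δu δv = finish
            (extend ok₁ ok₂ x∈ (diff uv uv₁) (diff (≢-sym xu) (≢-sym δu)) (diff (≢-sym xv) (≢-sym δv)))

          -- Either {y, z, u} or {y, z, v} can repeat a colour, or u, v, y, z form a K₄.
          adjacent-cut : ∀ {c₁} → E G u v → ¬ (∃[ δ ] All (δ ≢_) (c₁ u ∷ c₁ v ∷ c₁ y ∷ c₁ z ∷ [])) → Goal
          adjacent-cut {c₁} e-uv ¬fresh
            with (_ ∷ uy ∷ uz ∷ []) ∷ (vy ∷ vz ∷ []) ∷ (yz ∷ []) ∷ [] ∷ [] ← rainbow 3<colours ¬fresh
               | triangle? y z u | triangle? y z v
          ... | yes (e-yz , e-yu , e-zu) | yes (_ , e-yv , e-zv) =
            -- The clique bound gives 4 ≤ `3 + k`, hence at least five colours, so a fresh one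
            -- exists after all.
            contradiction (fresh (c₁ u ∷ c₁ v ∷ c₁ y ∷ c₁ z ∷ []) (s≤s (fit (lookup clique)
              (λ i → All.lookup clique⊆S₁ (∈-lookup i)) (AllPairs-lookup (E-sym G) clique-adj)))) ¬fresh
            where
            clique : List (Fin n)
            clique = u ∷ v ∷ y ∷ z ∷ []

            clique⊆S₁ : All (_∈ S₁) clique
            clique⊆S₁ = u∈₁ ∷ v∈₁ ∷ y∈ ∷ z∈ ∷ []

            clique-adj : AllPairs (E G) clique
            clique-adj = (e-uv ∷ E-sym G e-yu ∷ E-sym G e-zu ∷ [])
                       ∷ (E-sym G e-yv ∷ E-sym G e-zv ∷ []) ∷ (e-yz ∷ []) ∷ [] ∷ []
          ... | no ¬t | _
            with c′ , ok′ , t ← F₁.two y∈ z∈ u∈₁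
                   (yz ∘ cong c₁) (uy ∘ sym ∘ cong c₁) (uz ∘ sym ∘ cong c₁) ¬t
            with δ , δy , δz , δu , δv ← Two-fresh 3<colours t (c′ v) =
              use-E ok′ (ok′ u∈₁ v∈₁ e-uv) δu δv δy δz
          ... | _ | no ¬t
            with c′ , ok′ , t ← F₁.two y∈ z∈ v∈₁
                   (yz ∘ cong c₁) (vy ∘ sym ∘ cong c₁) (vz ∘ sym ∘ cong c₁) ¬t
            with δ , δy , δz , δv , δu ← Two-fresh 3<colours t (c′ u) =
              use-E ok′ (ok′ u∈₁ v∈₁ e-uv) δu δv δy δz

          E-goal : Goal
          E-goal with c₁ , ok₁ , uv₁ ← F₁.apart₂ u∈₁ v∈₁ u≢v
                 | fresh? (c₁ u ∷ c₁ v ∷ c₁ y ∷ c₁ z ∷ [])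
          ... | yes (δ , δu ∷ δv ∷ δy ∷ δz ∷ []) = use-E ok₁ uv₁ δu δv δy δz
          ... | no ¬fresh
            with (_ ∷ uy ∷ uz ∷ []) ∷ (vy ∷ vz ∷ []) ∷ _ ← rainbow 3<colours ¬fresh
               | triangle? u v x
          ...   | yes (e-uv , _) = adjacent-cut e-uv ¬fresh
          -- Without a triangle on `u`, `v`, `x`, the side of `x` also shows B, C or D. In C and D,
          -- `x` copies a cut vertex, whose colour differs from those of `y` and `z`.
          ...   | no ¬t with F₂.two u∈₂ v∈₂ x∈ u≢v (≢-sym (∉₁⇒≢ x∉ u∈₁)) (≢-sym (∉₁⇒≢ x∉ v∈₁)) ¬t
          ...     | c′ , ok′ , two₁₂ p q = use-B ok′ p q
          ...     | c′ , ok′ , two₁₃ p q =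
            finish (extend ok₁ ok′ x∈ (diff q uv₁) (same p refl)
                     (diff (λ r → q (trans p (sym r))) (≢-sym uv₁))) uy uz
          ...     | c′ , ok′ , two₂₃ p q =
            finish (extend ok₁ ok′ x∈ (diff q uv₁) (diff (λ r → q (trans r (sym p))) uv₁)
                     (same p refl)) vy vz

        result : Goal
        result with c₂ , ok₂ , xu , xv ← F₂.apart x∈ u∈₂ v∈₂ (∉₁⇒≢ x∉ u∈₁) (∉₁⇒≢ x∉ v∈₁)
               | c₂ u Fin.≟ c₂ v
        ... | yes uv = use-B ok₂ uv (≢-sym xu)
        ... | no uv = E-goal ok₂ xu xv uv

      -- The pattern of `z` on its side decides which colours it may take. It copies one of `x` and
      -- `y` when their colours differ, and avoids them when they agree.
      two-mixed : x ∈ S₁ → y ∈ S₁ → z ∈ S₂ → z ∉ S₁ → x ≢ y → ¬ (x ∈ S₂ × y ∈ S₂) →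
        ∃[ c ] Proper S c × Two (c x) (c y) (c z)
      two-mixed {x} {y} {z} x∈ y∈ z∈ z∉ x≢y ¬cut = result
        where
        Goal : Set
        Goal = ∃[ c₁ ] ∃[ γ ] Extends c₁ z γ × Two (c₁ x) (c₁ y) γ

        finish : Goal → ∃[ c ] Proper S c × Two (c x) (c y) (c z)
        finish (c₁ , γ , (c , ok , on₁ , c-z) , t) = c , ok , Two-resp (on₁ x∈) (on₁ y∈) c-z t

        use-B : ∀ {c₂} → Proper S₂ c₂ → c₂ u ≡ c₂ v → c₂ u ≢ c₂ z → Goal
        use-B {c₂} ok₂ uv uz with c₁ , ok₁ , uv₁ ← F₁.equal u∈₁ v∈₁ (λ e → ok₂ u∈₂ v∈₂ e uv) =
          c₁ , choose (c₁ x Fin.≟ c₁ y) (c₁ x Fin.≟ c₁ u)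
          where
          ext : ∀ {γ} → γ ≢ c₁ u → Extends c₁ z γ
          ext γu = extend ok₁ ok₂ z∈ (same uv uv₁) (diff uz (≢-sym γu))
            (diff (uz ∘ trans uv) (λ p → γu (trans (sym p) (sym uv₁))))

          choose : Dec (c₁ x ≡ c₁ y) → Dec (c₁ x ≡ c₁ u) →
                   ∃[ γ ] Extends c₁ z γ × Two (c₁ x) (c₁ y) γ
          choose (yes xy) _ = let γ , γu , γx , _ = fresh₃ 3<colours (c₁ u) (c₁ x) (c₁ x) in
            γ , ext γu , two₁₂ xy (≢-sym γx)
          -- Since `x` and `y` differ, at most one of them has the cut colour; `z` copies the other.
          choose (no xy) (yes xu) = c₁ y , ext (λ p → xy (trans xu (sym p))) , two₂₃ refl xy
          choose (no xy) (no xu)  = c₁ x , ext xu , two₁₃ refl xy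

        module _ {c₂ : Fin n → Colour} (ok₂ : Proper S₂ c₂)
                 (zu : c₂ z ≢ c₂ u) (zv : c₂ z ≢ c₂ v) (uv : c₂ u ≢ c₂ v) where

          use-E : ∀ {c₁ γ} → Proper S₁ c₁ → c₁ u ≢ c₁ v → γ ≢ c₁ u → γ ≢ c₁ v → Extends c₁ z γ
          use-E ok₁ uv₁ γu γv =
            extend ok₁ ok₂ z∈ (diff uv uv₁) (diff (≢-sym zu) (≢-sym γu)) (diff (≢-sym zv) (≢-sym γv))

          -- `a` is whichever of the two vertices lies off the cut: it can be kept apart from both
          -- `u` and `v`, so `z` can copy it. The edge keeps the colours of `u` and `v` distinct.
          adjacent-cut : E G u v → ∀ {a b} → a ∈ S₁ → a ∉ S₂ →
            ∃[ c₁ ] ∃[ γ ] Extends c₁ z γ × Two (c₁ a) (c₁ b) γ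
          adjacent-cut e {a} {b} a∈ a∉ =
            let c₁ , ok₁ , au , av = F₁.apart a∈ u∈₁ v∈₁ (∉₂⇒≢ a∉ u∈₂) (∉₂⇒≢ a∉ v∈₂)
                uv₁ = ok₁ u∈₁ v∈₁ e
                choose : Dec (c₁ a ≡ c₁ b) → ∃[ γ ] Extends c₁ z γ × Two (c₁ a) (c₁ b) γ
                choose = λ where
                  (yes ab) → let γ , γu , γv , γa = fresh₃ 3<colours (c₁ u) (c₁ v) (c₁ a) in
                    γ , use-E ok₁ uv₁ γu γv , two₁₂ ab (≢-sym γa)
                  (no ab) → c₁ a , use-E ok₁ uv₁ au av , two₁₃ refl ab
            in c₁ , choose (c₁ a Fin.≟ c₁ b)

          nonadjacent-cut : ¬ E G u v → Goal
          nonadjacent-cut ¬e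
            with F₂.two u∈₂ v∈₂ z∈ u≢v (≢-sym (∉₁⇒≢ z∉ u∈₁)) (≢-sym (∉₁⇒≢ z∉ v∈₁)) (¬e ∘ proj₁)
          ... | c′ , ok′ , two₁₂ p q = use-B ok′ p q
          ... | c′ , ok′ , inj₂ CD =
            c₁ , choose (c₁ x Fin.≟ c₁ y) (λ w → c₁ w Fin.≟ c₁ u) (λ w → c₁ w Fin.≟ c₁ v)
            where
            base : ∃[ c₁ ] Proper S₁ c₁ × c₁ u ≢ c₁ v
            base = F₁.apart₂ u∈₁ v∈₁ u≢v

            c₁  = proj₁ base
            ok₁ = proj₁ (proj₂ base)
            uv₁ = proj₂ (proj₂ base)

            use-CD : Extends c₁ z (c₁ u) ⊎ Extends c₁ z (c₁ v)
            use-CD = Sum.map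
              (λ (p , q) → extend ok₁ ok′ z∈ (diff q uv₁) (same p refl)
                 (diff (λ r → q (trans p (sym r))) (≢-sym uv₁)))
              (λ (p , q) → extend ok₁ ok′ z∈ (diff q uv₁) (diff (λ r → q (trans r (sym p))) uv₁)
                 (same p refl))
              CD

            choose : Dec (c₁ x ≡ c₁ y) → (∀ w → Dec (c₁ w ≡ c₁ u)) → (∀ w → Dec (c₁ w ≡ c₁ v)) →
                     ∃[ γ ] Extends c₁ z γ × Two (c₁ x) (c₁ y) γ
            choose (yes xy) _ _ = let γ , γu , γv , γx = fresh₃ 3<colours (c₁ u) (c₁ v) (c₁ x) in
              γ , use-E ok₁ uv₁ γu γv , two₁₂ xy (≢-sym γx)
            choose (no xy) ≟u ≟v with ≟u x | ≟v x | ≟u y | ≟v y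
            -- `z` copies a vertex whose colour is not on the cut, if there is one. Otherwise `x`
            -- and `y` carry the two cut colours, and pattern C or D lets `z` copy a cut vertex.
            ... | no xu  | no xv  | _      | _      = c₁ x , use-E ok₁ uv₁ xu xv , two₁₃ refl xy
            ... | _      | _      | no yu  | no yv  = c₁ y , use-E ok₁ uv₁ yu yv , two₂₃ refl xy
            ... | yes xu | _      | yes yu | _      = contradiction (trans xu (sym yu)) xy
            ... | _      | yes xv | _      | yes yv = contradiction (trans xv (sym yv)) xy
            ... | yes xu | _      | _      | yes yv =
              [ (λ ext → c₁ u , ext , two₁₃ xu xy) , (λ ext → c₁ v , ext , two₂₃ yv xy) ]′ use-CD
            ... | _      | yes xv | yes yu | _      =
              [ (λ ext → c₁ u , ext , two₂₃ yu xy) , (λ ext → c₁ v , ext , two₁₃ xv xy) ]′ use-CD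

          E-goal : Dec (E G u v) → Dec (x ∈ S₂) → Dec (y ∈ S₂) → Goal
          E-goal (no ¬e) _ _ = nonadjacent-cut ¬e
          E-goal (yes e) (no x∉) _ = adjacent-cut e x∈ x∉
          E-goal (yes e) _ (no y∉) = map₂ (map₂ (map₂ Two-swap₁₂)) (adjacent-cut e y∈ y∉)
          E-goal (yes _) (yes x∈₂) (yes y∈₂) = contradiction (x∈₂ , y∈₂) ¬cut

        result : ∃[ c ] Proper S c × Two (c x) (c y) (c z)
        result with c₂ , ok₂ , zu , zv ← F₂.apart z∈ u∈₂ v∈₂ (∉₁⇒≢ z∉ u∈₁) (∉₁⇒≢ z∉ v∈₁)
               | c₂ u Fin.≟ c₂ v
        ... | yes uv = finish (use-B ok₂ uv (≢-sym zu))
        ... | no uv  = finish (E-goal ok₂ zu zv uv (E-dec G u v) (x ∈? S₂) (y ∈? S₂))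

  -- Case analysis on the position of the vertices relative to the cut.

  module _ (sep : Separation S)
           (F₁ : Flexible (Separation.S₁ sep)) (F₂ : Flexible (Separation.S₂ sep)) where
    open Separation sep
    private
      module F₁ = Flexible F₁
      module F₂ = Flexible F₂

      sep′ : Separation S
      sep′ = flip-sides sep

    in-S₂ : i ∈ S → i ∉ S₁ → i ∈ S₂
    in-S₂ i∈ i∉ = [ (λ p → contradiction p i∉) , id ]′ (cover i∈)

    in-S₁ : i ∈ S → i ∉ S₂ → i ∈ S₁
    in-S₁ i∈ i∉ = [ id , (λ p → contradiction p i∉) ]′ (cover i∈)

    -- Each side is coloured with its vertex apart from the cut, showing B or E. Equal patterns join
    -- at once; the mixed case is `equal-BE`, up to a swap of sides.
    equal-cross : x ∈ S₁ → x ∉ S₂ → y ∈ S₂ → y ∉ S₁ → ∃[ c ] Proper {4 + k} S c × c x ≡ c y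
    equal-cross {x} {y} x∈ x∉ y∈ y∉
      with c₁ , ok₁ , xu , xv ← F₁.apart x∈ u∈₁ v∈₁ (λ { refl → x∉ u∈₂ }) (λ { refl → x∉ v∈₂ })
         | c₂ , ok₂ , yu , yv ← F₂.apart y∈ u∈₂ v∈₂ (λ { refl → y∉ u∈₁ }) (λ { refl → y∉ v∈₁ })
      = choose (c₁ u Fin.≟ c₁ v) (c₂ u Fin.≟ c₂ v)
      where
      join : (c₂ u , c₂ v) ∼ (c₁ u , c₁ v) → ∃[ c ] Proper S c × c x ≡ c y
      join uv = let c , ok , on₁ , c-y = Gluing.extend sep ok₁ ok₂ y∈ uv
                      (diff (≢-sym yu) (≢-sym xu)) (diff (≢-sym yv) (≢-sym xv))
                in c , ok , trans (on₁ x∈) (sym c-y)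

      choose : Dec (c₁ u ≡ c₁ v) → Dec (c₂ u ≡ c₂ v) → ∃[ c ] Proper S c × c x ≡ c y
      choose (yes p) (yes q) = join (same q p)
      choose (no p)  (no q)  = join (diff q p)
      choose (yes p) (no q)  = Gluing.equal-BE sep F₁ F₂ x∈ y∈ x∉ y∉ ok₁ p xu xv ok₂ q yu yv
      choose (no p)  (yes q) =
        let c , ok , eq = Gluing.equal-BE sep′ F₂ F₁ y∈ x∈ y∉ x∉ ok₂ q yu yv ok₁ p xu xv
        in c , ok , sym eq

    -- A cut vertex lies on both sides and so always falls under a `within` case; the `across` cases
    -- place both vertices off the cut.
    data Placement (x y : Fin n) : Set where
      within₁ : x ∈ S₁ → y ∈ S₁ → Placement x y
      within₂ : x ∈ S₂ → y ∈ S₂ → Placement x y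
      across  : x ∈ S₁ → x ∉ S₂ → y ∈ S₂ → y ∉ S₁ → Placement x y
      across′ : x ∈ S₂ → x ∉ S₁ → y ∈ S₁ → y ∉ S₂ → Placement x y

    place : x ∈ S → y ∈ S → Placement x y
    place {x} {y} x∈ y∈ with x ∈? S₁ | y ∈? S₁
    ... | yes x∈₁ | yes y∈₁ = within₁ x∈₁ y∈₁
    ... | no x∉₁  | no y∉₁  = within₂ (in-S₂ x∈ x∉₁) (in-S₂ y∈ y∉₁)
    ... | yes x∈₁ | no y∉₁ with x ∈? S₂
    ...   | yes x∈₂ = within₂ x∈₂ (in-S₂ y∈ y∉₁)
    ...   | no x∉₂  = across x∈₁ x∉₂ (in-S₂ y∈ y∉₁) y∉₁
    place {x} {y} x∈ y∈ | no x∉₁ | yes y∈₁ with y ∈? S₂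
    ...   | yes y∈₂ = within₂ (in-S₂ x∈ x∉₁) y∈₂
    ...   | no y∉₂  = across′ (in-S₂ x∈ x∉₁) x∉₁ y∈₁ y∉₂

    equal-step : x ∈ S → y ∈ S → ¬ E G x y → ∃[ c ] Proper {4 + k} S c × c x ≡ c y
    equal-step x∈ y∈ ¬e with place x∈ y∈
    ... | within₁ x∈₁ y∈₁ = Gluing.equal₁ sep F₁ F₂ x∈₁ y∈₁ ¬e
    ... | within₂ x∈₂ y∈₂ = Gluing.equal₁ sep′ F₂ F₁ x∈₂ y∈₂ ¬e
    ... | across x∈₁ x∉₂ y∈₂ y∉₁ = equal-cross x∈₁ x∉₂ y∈₂ y∉₁
    ... | across′ x∈₂ x∉₁ y∈₁ y∉₂ =
      let c , ok , eq = equal-cross y∈₁ y∉₂ x∈₂ x∉₁ in c , ok , sym eq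

    Apart : Fin n → Fin n → Fin n → Set
    Apart x y z = ∃[ c ] Proper {4 + k} S c × c x ≢ c y × c x ≢ c z

    Apart-comm : Apart x z y → Apart x y z
    Apart-comm (c , ok , p , q) = c , ok , q , p

    apart-mixed : x ∈ S → y ∈ S₁ → y ∉ S₂ → z ∈ S₂ → z ∉ S₁ → x ≢ y → x ≢ z → Apart x y z
    apart-mixed {x} x∈ y∈ y∉ z∈ z∉ x≢y x≢z with x ∈? S₁ | x ∈? S₂
    ... | yes x∈₁ | no x∉₂ = Gluing.apart-off-cut sep F₁ F₂ x∈₁ x∉₂ y∈ z∈ z∉ x≢y
    ... | no x∉₁  | _ =
      Apart-comm (Gluing.apart-off-cut sep′ F₂ F₁ (in-S₂ x∈ x∉₁) x∉₁ z∈ y∈ y∉ x≢z)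
    ... | yes x∈₁ | yes x∈₂ with meet x∈₁ x∈₂
    ...   | inj₁ refl = Gluing.apart-at-cut sep F₁ F₂ y∈ z∈ x≢y x≢z
    ...   | inj₂ refl = Gluing.apart-at-cut (flip-cut sep) F₁ F₂ y∈ z∈ x≢y x≢z

    module _ (K₁ : CliquesFit S₁) (K₂ : CliquesFit S₂) where

      apart-within₁ : x ∈ S → y ∈ S₁ → z ∈ S₁ → x ≢ y → x ≢ z → Apart x y z
      apart-within₁ {x} x∈ y∈ z∈ x≢y x≢z with x ∈? S₁
      ... | yes x∈₁ = Gluing.apart₁ sep F₁ F₂ x∈₁ y∈ z∈ x≢y x≢z
      ... | no x∉₁  = Gluing.apart-opposite sep F₁ F₂ K₁ (in-S₂ x∈ x∉₁) x∉₁ y∈ z∈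

      apart-within₂ : x ∈ S → y ∈ S₂ → z ∈ S₂ → x ≢ y → x ≢ z → Apart x y z
      apart-within₂ {x} x∈ y∈ z∈ x≢y x≢z with x ∈? S₂
      ... | yes x∈₂ = Gluing.apart₁ sep′ F₂ F₁ x∈₂ y∈ z∈ x≢y x≢z
      ... | no x∉₂  = Gluing.apart-opposite sep′ F₂ F₁ K₂ (in-S₁ x∈ x∉₂) x∉₂ y∈ z∈

      apart-step : x ∈ S → y ∈ S → z ∈ S → x ≢ y → x ≢ z → Apart x y z
      apart-step x∈ y∈ z∈ x≢y x≢z with place y∈ z∈
      ... | within₁ y∈₁ z∈₁ = apart-within₁ x∈ y∈₁ z∈₁ x≢y x≢z
      ... | within₂ y∈₂ z∈₂ = apart-within₂ x∈ y∈₂ z∈₂ x≢y x≢z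
      ... | across y∈₁ y∉₂ z∈₂ z∉₁ = apart-mixed x∈ y∈₁ y∉₂ z∈₂ z∉₁ x≢y x≢z
      ... | across′ y∈₂ y∉₁ z∈₁ z∉₂ = Apart-comm (apart-mixed x∈ z∈₁ z∉₂ y∈₂ y∉₁ x≢z x≢y)

    two-within₁ : x ∈ S₁ → y ∈ S₁ → z ∈ S → x ≢ y → x ≢ z → y ≢ z → ¬ Triangle x y z →
                  ∃[ c ] Proper {4 + k} S c × Two (c x) (c y) (c z)
    two-within₁ {x} {y} {z} x∈ y∈ z∈ x≢y x≢z y≢z ¬t with z ∈? S₁ | x ∈? S₂ ×-dec y ∈? S₂
    ... | yes z∈₁ | _ = Gluing.two₁ sep F₁ F₂ x∈ y∈ z∈₁ x≢y x≢z y≢z ¬t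
    ... | no z∉₁  | yes (x∈₂ , y∈₂) =
      Gluing.two₁ sep′ F₂ F₁ x∈₂ y∈₂ (in-S₂ z∈ z∉₁) x≢y x≢z y≢z ¬t
    ... | no z∉₁  | no ¬cut = Gluing.two-mixed sep F₁ F₂ x∈ y∈ (in-S₂ z∈ z∉₁) z∉₁ x≢y ¬cut

  module _ (sep : Separation S) where
    open Separation sep

    -- Two of the three vertices share a side, and `Two` is symmetric, so they can be moved to the
    -- front.
    two-step : Flexible S₁ → Flexible S₂ → x ∈ S → y ∈ S → z ∈ S →
      x ≢ y → x ≢ z → y ≢ z → ¬ Triangle x y z → ∃[ c ] Proper {4 + k} S c × Two (c x) (c y) (c z)
    two-step {x} {y} {z} F₁ F₂ x∈ y∈ z∈ x≢y x≢z y≢z ¬t = go (cover x∈) (cover y∈) (cover z∈)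
      where
      Goal : Fin n → Fin n → Fin n → Set
      Goal x y z = ∃[ c ] Proper {4 + k} S c × Two (c x) (c y) (c z)

      ¬t-xzy : ¬ Triangle x z y
      ¬t-xzy (xz , xy , zy) = ¬t (xy , xz , E-sym G zy)

      ¬t-yzx : ¬ Triangle y z x
      ¬t-yzx (yz , yx , zx) = ¬t (E-sym G yx , E-sym G zx , yz)

      xzy : Goal x z y → Goal x y z
      xzy (c , ok , t) = c , ok , Two-swap₂₃ t

      yzx : Goal y z x → Goal x y z
      yzx (c , ok , t) = c , ok , Two-swap₁₂ (Two-swap₂₃ t)

      go : x ∈ S₁ ⊎ x ∈ S₂ → y ∈ S₁ ⊎ y ∈ S₂ → z ∈ S₁ ⊎ z ∈ S₂ → Goal x y z
      go (inj₁ p) (inj₁ q) _        = two-within₁ sep F₁ F₂ p q z∈ x≢y x≢z y≢z ¬t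
      go (inj₂ p) (inj₂ q) _        = two-within₁ (flip-sides sep) F₂ F₁ p q z∈ x≢y x≢z y≢z ¬t
      go (inj₁ p) _        (inj₁ r) = xzy (two-within₁ sep F₁ F₂ p r y∈ x≢z x≢y (≢-sym y≢z) ¬t-xzy)
      go (inj₂ p) _        (inj₂ r) =
        xzy (two-within₁ (flip-sides sep) F₂ F₁ p r y∈ x≢z x≢y (≢-sym y≢z) ¬t-xzy)
      go _        (inj₁ q) (inj₁ r) =
        yzx (two-within₁ sep F₁ F₂ q r x∈ y≢z (≢-sym x≢y) (≢-sym x≢z) ¬t-yzx)
      go _        (inj₂ q) (inj₂ r) =
        yzx (two-within₁ (flip-sides sep) F₂ F₁ q r x∈ y≢z (≢-sym x≢y) (≢-sym x≢z) ¬t-yzx)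

    flexible-glue : CliquesFit S₁ → CliquesFit S₂ → Flexible S₁ → Flexible S₂ → Flexible S
    flexible-glue K₁ K₂ F₁ F₂ = record
      { equal = equal-step sep F₁ F₂
      ; apart = apart-step sep F₁ F₂ K₁ K₂
      ; two   = two-step F₁ F₂
      }

    -- A clique vertex outside `S₂` has all its edges inside `S₁`, and these reach the whole clique.
    cliques-fit-glue : CliquesFit S₁ → CliquesFit S₂ → CliquesFit S
    cliques-fit-glue fit₁ fit₂ q q∈ adj with Fin.all? (λ i → q i ∈? S₂)
    ... | yes q∈₂ = fit₂ q q∈₂ adj
    ... | no ¬q∈₂ with i , i∉ ← Fin.¬∀⟶∃¬ _ _ (λ i → q i ∈? S₂) ¬q∈₂ = fit₁ q q∈₁ adj
      where
      q∈₁ : ∀ j → q j ∈ S₁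
      q∈₁ j with i Fin.≟ j
      ... | yes refl = [ id , (λ p → contradiction p i∉) ]′ (cover (q∈ i))
      ... | no i≢j with edge (q∈ i) (q∈ j) (adj i≢j)
      ...   | inj₁ (_ , j∈) = j∈
      ...   | inj₂ (i∈ , _) = contradiction i∈ i∉

  -- Flexibility from a colouring with one colour to spare.

  module _ {c : Fin n → Fin (3 + k)} (c-ok : Proper S c) where

    colourable⇒cliques-fit : CliquesFit S
    colourable⇒cliques-fit q q∈ adj = ℕ.≮⇒≥ λ 3+k<r →
      let i , j , i<j , eq = Fin.pigeonhole 3+k<r (c ∘ q)
      in c-ok (q∈ i) (q∈ j) (adj (Fin.<⇒≢ i<j)) eq

    -- The old colours are shifted by `suc`, which frees `zero` for the vertices satisfying `P`;
    -- `mark-proper` asks these to be independent.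
    mark : {P : Fin n → Set} → (∀ i → Dec (P i)) → Fin n → Colour
    mark P? i with P? i
    ... | yes _ = zero
    ... | no _  = suc (c i)

    mark-in : {P : Fin n → Set} (P? : ∀ i → Dec (P i)) → P i → mark P? i ≡ zero
    mark-in {i} P? p with P? i
    ... | yes _ = refl
    ... | no ¬p = contradiction p ¬p

    mark-out : {P : Fin n → Set} (P? : ∀ i → Dec (P i)) → ¬ P i → mark P? i ≡ suc (c i)
    mark-out {i} P? ¬p with P? i
    ... | yes p = contradiction p ¬p
    ... | no _  = refl

    mark-proper : {P : Fin n → Set} (P? : ∀ i → Dec (P i)) →
      (∀ {a b} → P a → P b → ¬ E G a b) → Proper S (mark P?)
    mark-proper P? indep {a} {b} a∈ b∈ e eq with P? a | P? b
    ... | yes pa | yes pb = indep pa pb e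
    ... | no _   | no _   = c-ok a∈ b∈ e (Fin.suc-injective eq)

    mark-pair : ¬ E G x y → ∃[ c′ ] Proper {4 + k} S c′ × c′ x ≡ zero × c′ y ≡ zero ×
                (∀ {i} → i ≢ x → i ≢ y → c′ i ≢ zero)
    mark-pair {x} {y} ¬e = mark P? , mark-proper P? indep
      , mark-in P? (inj₁ refl) , mark-in P? (inj₂ refl) , outside-pair
      where
      P? : ∀ i → Dec (i ≡ x ⊎ i ≡ y)
      P? i = i Fin.≟ x ⊎-dec i Fin.≟ y

      indep : ∀ {a b} → a ≡ x ⊎ a ≡ y → b ≡ x ⊎ b ≡ y → ¬ E G a b
      indep (inj₁ refl) (inj₁ refl) = E-irrefl G refl
      indep (inj₁ refl) (inj₂ refl) = ¬e
      indep (inj₂ refl) (inj₁ refl) = ¬e ∘ E-sym G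
      indep (inj₂ refl) (inj₂ refl) = E-irrefl G refl

      outside-pair : ∀ {i} → i ≢ x → i ≢ y → mark P? i ≢ zero
      outside-pair i≢x i≢y eq with () ← trans (sym eq) (mark-out P? [ i≢x , i≢y ]′)

    colourable⇒flexible : Flexible S
    colourable⇒flexible = record { equal = λ _ _ → eq ; apart = λ _ _ _ → ap ; two = λ _ _ _ → tw }
      where
      eq : ¬ E G x y → ∃[ c′ ] Proper S c′ × c′ x ≡ c′ y
      eq ¬e = let c′ , ok , x0 , y0 , _ = mark-pair ¬e in c′ , ok , trans x0 (sym y0)

      ap : x ≢ y → x ≢ z → ∃[ c′ ] Proper S c′ × c′ x ≢ c′ y × c′ x ≢ c′ z
      ap x≢y x≢z =
        -- Pairing `x` with itself marks `x` alone.
        let c′ , ok , x0 , _ , other = mark-pair (E-irrefl G refl)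
        in c′ , ok , (λ p → other (≢-sym x≢y) (≢-sym x≢y) (trans (sym p) x0))
         , (λ p → other (≢-sym x≢z) (≢-sym x≢z) (trans (sym p) x0))

      tw : x ≢ y → x ≢ z → y ≢ z → ¬ Triangle x y z →
           ∃[ c′ ] Proper S c′ × Two (c′ x) (c′ y) (c′ z)
      tw {x} {y} {z} x≢y x≢z y≢z ¬t with E-dec G x y | E-dec G x z | E-dec G y z
      ... | no ¬xy | _ | _ =
        let c′ , ok , x0 , y0 , other = mark-pair ¬xy
        in c′ , ok , two₁₂ (trans x0 (sym y0)) λ p → other (≢-sym x≢z) (≢-sym y≢z) (trans (sym p) x0)
      ... | _ | no ¬xz | _ =
        let c′ , ok , x0 , z0 , other = mark-pair ¬xz
        in c′ , ok , two₁₃ (trans x0 (sym z0)) λ p → other (≢-sym x≢y) y≢z (trans (sym p) x0)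
      ... | _ | _ | no ¬yz =
        let c′ , ok , y0 , z0 , other = mark-pair ¬yz
        in c′ , ok , two₂₃ (trans y0 (sym z0)) λ p → other x≢y x≢z (trans p y0)
      ... | yes xy | yes xz | yes yz = contradiction (xy , xz , yz) ¬t

  -- Induced subgraphs, two-vertex cuts and 3-connectivity.

  induced : Subset n → Graph n
  induced S = record
    { V        = S
    ; E        = λ a b → E G a b × a ∈ S × b ∈ S
    ; E-dec    = λ a b → E-dec G a b ×-dec a ∈? S ×-dec b ∈? S
    ; E-sym    = λ (e , a∈ , b∈) → E-sym G e , b∈ , a∈
    ; E-irrefl = λ eq (e , _) → E-irrefl G eq e
    ; E⇒∈V     = λ (_ , a∈ , _) → a∈
    }

  colourable⇒proper : ∀ {m} → Colourable (suc m) (induced S) → ∃[ c ] Proper {suc m} S c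
  colourable⇒proper {S} {m} (c , c-ok) = (λ i → total i (i ∈? S)) , ok
    where
    total : ∀ i → Dec (i ∈ S) → Fin (suc m)
    total i (yes i∈) = c (i , i∈)
    total i (no _)   = zero

    ok : Proper S (λ i → total i (i ∈? S))
    ok {a} {b} a∈ b∈ e with a ∈? S | b ∈? S
    ... | yes a∈′ | yes b∈′ = c-ok (a , a∈′) (b , b∈′) (e , a∈ , b∈)
    ... | no a∉   | _       = contradiction a∈ a∉
    ... | _       | no b∉   = contradiction b∈ b∉

  module _ (S : Subset n) where

    Rest : Fin n → Fin n → Subset n → Fin n → Set
    Rest u v A b = b ∈ S × b ∉ A × b ≢ u × b ≢ v

    Exit : Fin n → Fin n → Subset n → Set
    Exit u v A = ∃₂ λ a b → a ∈ A × Rest u v A b × E G a b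

    -- `A` is a nonempty union of components left after deleting `u` and `v`, but not all of them.
    -- Phrasing this by vertex subsets instead of paths makes it decidable by finite search.
    Separates : Fin n → Fin n → Subset n → Set
    Separates u v A = u ≢ v × u ∈ S × v ∈ S × A ⊆ S × u ∉ A × v ∉ A ×
                      Nonempty A × ∃ (Rest u v A) × ¬ Exit u v A

    rest? : ∀ u v A b → Dec (Rest u v A b)
    rest? u v A b = b ∈? S ×-dec ¬? (b ∈? A) ×-dec ¬? (b Fin.≟ u) ×-dec ¬? (b Fin.≟ v)

    exit? : ∀ u v A → Dec (Exit u v A)
    exit? u v A = Fin.any? λ a → Fin.any? λ b → a ∈? A ×-dec rest? u v A b ×-dec E-dec G a b

    separates? : ∀ u v A → Dec (Separates u v A)
    separates? u v A = ¬? (u Fin.≟ v) ×-dec u ∈? S ×-dec v ∈? S ×-dec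
      A ⊆? S ×-dec ¬? (u ∈? A) ×-dec ¬? (v ∈? A) ×-dec
      nonempty? A ×-dec Fin.any? (rest? u v A) ×-dec ¬? (exit? u v A)

    separation : ∀ {u v A} → Separates u v A → Separation S
    separation {u} {v} {A} (u≢v , u∈ , v∈ , A⊆S , u∉A , v∉A ,
        (a₀ , a₀∈) , (b₀ , b₀∈ , b₀∉ , b₀≢u , b₀≢v) , closed) =
      record
        { u≢v = u≢v
        ; u∈₁ = u∈₁ ; u∈₂ = x∈p∩q⁺ (u∈ , x∉p⇒x∈∁p u∉A)
        ; v∈₁ = v∈₁ ; v∈₂ = x∈p∩q⁺ (v∈ , x∉p⇒x∈∁p v∉A)
        -- `b₀` lies beyond `A` and the cut, so `S₁` is a proper subset; `a₀` does the same for
        -- `S₂`.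
        ; S₁⊂S = S₁⊆S , b₀ , b₀∈ , λ b₀∈₁ → [ b₀∉ , [ b₀≢u , b₀≢v ]′ ]′ (S₁⁻ b₀∈₁)
        ; S₂⊂S = p∩q⊆p S (∁ A) , a₀ , A⊆S a₀∈ , λ a₀∈₂ → S₂⇒∉A a₀∈₂ a₀∈
        ; cover = λ {i} → cover i
        ; meet = λ i∈₁ i∈₂ → [ (λ i∈A → contradiction i∈A (S₂⇒∉A i∈₂)) , id ]′ (S₁⁻ i∈₁)
        ; edge = λ {a} {b} → edge a b
        }
      where
      S₁ S₂ : Subset n
      S₁ = A ∪ ⁅ u ⁆ ∪ ⁅ v ⁆
      S₂ = S ∩ ∁ A

      A⊆S₁ : A ⊆ S₁
      A⊆S₁ = p⊆p∪q (⁅ u ⁆ ∪ ⁅ v ⁆)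

      u∈₁ : u ∈ S₁
      u∈₁ = x∈p∪q⁺ (inj₂ (x∈p∪q⁺ (inj₁ (x∈⁅x⁆ u))))

      v∈₁ : v ∈ S₁
      v∈₁ = x∈p∪q⁺ (inj₂ (x∈p∪q⁺ (inj₂ (x∈⁅x⁆ v))))

      S₁⁻ : i ∈ S₁ → i ∈ A ⊎ i ≡ u ⊎ i ≡ v
      S₁⁻ i∈ = Sum.map₂ (Sum.map (x∈⁅y⁆⇒x≡y u) (x∈⁅y⁆⇒x≡y v) ∘ x∈p∪q⁻ ⁅ u ⁆ ⁅ v ⁆)
                 (x∈p∪q⁻ A (⁅ u ⁆ ∪ ⁅ v ⁆) i∈)

      S₁⊆S : S₁ ⊆ S
      S₁⊆S i∈ with S₁⁻ i∈
      ... | inj₁ i∈A = A⊆S i∈A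
      ... | inj₂ (inj₁ refl) = u∈
      ... | inj₂ (inj₂ refl) = v∈

      S₂⇒∉A : i ∈ S₂ → i ∉ A
      S₂⇒∉A i∈ = x∈∁p⇒x∉p (proj₂ (x∈p∩q⁻ S (∁ A) i∈))

      cover : ∀ i → i ∈ S → i ∈ S₁ ⊎ i ∈ S₂
      cover i i∈ with i ∈? A
      ... | yes i∈A = inj₁ (A⊆S₁ i∈A)
      ... | no i∉A  = inj₂ (x∈p∩q⁺ (i∈ , x∉p⇒x∈∁p i∉A))

      neighbour∈S₁ : ∀ a b → a ∈ A → b ∈ S → E G a b → b ∈ S₁
      neighbour∈S₁ a b a∈A b∈ e with b ∈? A | b Fin.≟ u | b Fin.≟ v
      ... | yes b∈A | _        | _        = A⊆S₁ b∈A
      ... | _       | yes refl | _        = u∈₁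
      ... | _       | _        | yes refl = v∈₁
      ... | no b∉A  | no b≢u   | no b≢v   =
        contradiction (a , b , a∈A , (b∈ , b∉A , b≢u , b≢v) , e) closed

      edge : ∀ a b → a ∈ S → b ∈ S → E G a b → (a ∈ S₁ × b ∈ S₁) ⊎ (a ∈ S₂ × b ∈ S₂)
      edge a b a∈ b∈ e with a ∈? A | b ∈? A
      ... | yes a∈A | _       = inj₁ (A⊆S₁ a∈A , neighbour∈S₁ a b a∈A b∈ e)
      ... | _       | yes b∈A = inj₁ (neighbour∈S₁ b a b∈A a∈ (E-sym G e) , A⊆S₁ b∈A)
      ... | no a∉A  | no b∉A  =
        inj₂ (x∈p∩q⁺ (a∈ , x∉p⇒x∈∁p a∉A) , x∈p∩q⁺ (b∈ , x∉p⇒x∈∁p b∉A))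

    module _ (unseparated : ∀ u v A → ¬ Separates u v A) where

      -- `A` collects vertices joined to `x` by paths avoiding `X`. While it misses `y` it has an
      -- exit, or it would separate `S`; adding the endpoint of that exit enlarges `A`, which can
      -- happen only finitely often.
      reach : ∀ {X u v} → u ≢ v → u ∈ S → v ∈ S → (∀ {i} → i ∈ X → i ≡ u ⊎ i ≡ v) →
        y ∈ S → y ≢ u → y ≢ v → ∀ {A} → Acc _⊃_ A → A ⊆ S → u ∉ A → v ∉ A → x ∈ A →
        (∀ {a} → a ∈ A → Star (E (induced S ∖ X)) x a) → Star (E (induced S ∖ X)) x y
      reach {y} {x} {X} {u} {v} u≢v u∈ v∈ X⊆uv y∈ y≢u y≢v {A} (acc rec) A⊆S u∉A v∉A x∈A path
        with y ∈? A | exit? u v A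
      ... | yes y∈A | _ = path y∈A
      ... | no y∉A | no closed with () ← unseparated u v A
        (u≢v , u∈ , v∈ , A⊆S , u∉A , v∉A , (x , x∈A) , (y , y∈ , y∉A , y≢u , y≢v) , closed)
      ... | no _ | yes (a , b , a∈A , (b∈ , b∉A , b≢u , b≢v) , e) =
        reach u≢v u∈ v∈ X⊆uv y∈ y≢u y≢v
          (rec (p⊆p∪q ⁅ b ⁆ , b , x∈p∪q⁺ (inj₂ (x∈⁅x⁆ b)) , b∉A))
          ([ A⊆S , (λ { refl → b∈ }) ]′ ∘ A∪b⁻)
          ([ u∉A , ≢-sym b≢u ]′ ∘ A∪b⁻) ([ v∉A , ≢-sym b≢v ]′ ∘ A∪b⁻)
          (p⊆p∪q ⁅ b ⁆ x∈A) ([ path , (λ { refl → path a∈A ◅◅ step ◅ ε }) ]′ ∘ A∪b⁻)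
        where
        A∪b⁻ : ∀ {i} → i ∈ A ∪ ⁅ b ⁆ → i ∈ A ⊎ i ≡ b
        A∪b⁻ i∈ = Sum.map₂ (x∈⁅y⁆⇒x≡y b) (x∈p∪q⁻ A ⁅ b ⁆ i∈)

        ∉X : ∀ {i} → i ≢ u → i ≢ v → i ∉ X
        ∉X i≢u i≢v i∈ = [ i≢u , i≢v ]′ (X⊆uv i∈)

        step : E (induced S ∖ X) a b
        step = (e , A⊆S a∈A , b∈) , ∉X (λ { refl → u∉A a∈A }) (λ { refl → v∉A a∈A }) , ∉X b≢u b≢v

      unseparated⇒3-connected : 3 < ∣ S ∣ → KConnected 3 (induced S)
      unseparated⇒3-connected 3<∣S∣ = 3<∣S∣ , λ (X , (X⊆S , ¬conn) , ∣X∣<3) →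
        ¬conn λ (x , x∈) (y , y∈) → connect X⊆S ∣X∣<3 x∈ y∈ (x Fin.≟ y)
        where
        -- A set of at most two vertices grows to exactly two, avoiding x and y, as 3 < ∣ S ∣.
        connect : ∀ {X x y} → X ⊆ S → ∣ X ∣ < 3 → x ∈ S ─ X → y ∈ S ─ X → Dec (x ≡ y) →
                  Star (E (induced S ∖ X)) x y
        connect _ _ _ _ (yes refl) = ε
        connect {X} {x} {y} X⊆S ∣X∣<3 x∈ y∈ (no x≢y) =
          let u , v , u≢v , u∈ , v∈ , X⊆uv = enclose-in-pair (S - x - y) X avoid ∣X∣<3 large
              ∈S  = λ {i} (i∈ : i ∈ S - x - y) → x∈p-y⇒x∈p S (x∈p-y⇒x∈p (S - x) i∈)
              ≢x  = λ {i} (i∈ : i ∈ S - x - y) → x∈p-y⇒x≢y S (x∈p-y⇒x∈p (S - x) i∈)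
              ≢y  = λ {i} (i∈ : i ∈ S - x - y) → x∈p-y⇒x≢y (S - x) i∈
          in reach u≢v (∈S u∈) (∈S v∈) X⊆uv (p─q⊆p S X y∈) (≢-sym (≢y u∈)) (≢-sym (≢y v∈))
               (⊃-wellFounded ⁅ x ⁆) (λ i∈ → subst (_∈ S) (sym (x∈⁅y⁆⇒x≡y x i∈)) (p─q⊆p S X x∈))
               (x≢y⇒x∉⁅y⁆ (≢x u∈)) (x≢y⇒x∉⁅y⁆ (≢x v∈)) (x∈⁅x⁆ x)
               (λ i∈ → subst (Star _ x) (sym (x∈⁅y⁆⇒x≡y x i∈)) ε)
          where
          avoid : X ⊆ S - x - y
          avoid i∈ = x∈p∧x≢y⇒x∈p-y
            (x∈p∧x≢y⇒x∈p-y (X⊆S i∈) (λ { refl → x∈p─q⇒x∉q S X x∈ i∈ }))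
            (λ { refl → x∈p─q⇒x∉q S X y∈ i∈ })

          large : 1 < ∣ S - x - y ∣
          large = s≤s⁻¹ (s≤s⁻¹ (ℕ.≤-trans 3<∣S∣
            (ℕ.≤-trans (∣p∣≤1+∣p-x∣ S x) (s≤s (∣p∣≤1+∣p-x∣ (S - x) y)))))

  -- Induction on the vertex set.

  module _ (fragile : Fragile (4 + k) G) where

    -- At most three vertices get distinct colours. Otherwise a search either finds a separating
    -- pair or shows the induced subgraph to be 3-connected, and then fragility colours it.
    colourable⊎separation : S ⊆ V G → ∃ (Proper {3 + k} S) ⊎ Separation S
    colourable⊎separation {S} S⊆V with ∣ S ∣ ℕ.≤? 3
      | Fin.any? (λ u → Fin.any? (λ v → anySubset? (separates? S u v)))
    ... | yes ∣S∣≤3 | _ =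
      let c , inj = injective-colouring S (ℕ.≤-trans ∣S∣≤3 (ℕ.m≤m+n 3 k))
      in inj₁ (c , λ a∈ b∈ e eq → E-irrefl G (inj a∈ b∈ eq) e)
    ... | no _ | yes (_ , _ , _ , sep) = inj₂ (separation S sep)
    ... | no ∣S∣≰3 | no ¬sep = inj₁ (colourable⇒proper (fragile (induced S) (S⊆V , proj₁)
      (unseparated⇒3-connected S (λ u v A sep → ¬sep (u , v , A , sep)) (ℕ.≰⇒> ∣S∣≰3))))

    -- The clique bound travels with flexibility because `apart` on a glued set relies on the bound
    -- for both sides.
    fragile⇒flexible : Acc _⊂_ S → S ⊆ V G → Flexible S × CliquesFit S
    fragile⇒flexible (acc rec) S⊆V with colourable⊎separation S⊆V
    ... | inj₁ (c , ok) = colourable⇒flexible ok , colourable⇒cliques-fit ok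
    ... | inj₂ sep =
      let open Separation sep
          F₁ , fit₁ = fragile⇒flexible (rec S₁⊂S) (λ i∈ → S⊆V (proj₁ S₁⊂S i∈))
          F₂ , fit₂ = fragile⇒flexible (rec S₂⊂S) (λ i∈ → S⊆V (proj₁ S₂⊂S i∈))
      in flexible-glue sep fit₁ fit₂ F₁ F₂ , cliques-fit-glue sep fit₁ fit₂

theorem3 : ∀ (m : ℕ) → 4 ≤ m → ∀ {n : ℕ} (G : Graph n) → Fragile m G →
    (∀ (x y : Vertex G) → ¬ Adjacent G x y →
    ∃[ c ] IsColouring G m c × c x ≡ c y)
    ×
    (∀ (x y : Vertex G) → x ≢ y →
    ∃[ c ] IsColouring G m c × c x ≢ c y)
    ×
    (∀ (x y z : Vertex G) → x ≢ y → x ≢ z → y ≢ z →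
    ∃[ c ] IsColouring G m c × c x ∉ ⁅ c y ⁆ ∪ ⁅ c z ⁆)
    ×
    (∀ (x y z : Vertex G) → x ≢ y → x ≢ z → y ≢ z →
    ¬ (Adjacent G x y × Adjacent G x z × Adjacent G y z) →
    ∃[ c ] IsColouring G m c × ∣ ⁅ c x ⁆ ∪ ⁅ c y ⁆ ∪ ⁅ c z ⁆ ∣ ≡ 2)
theorem3 (suc (suc (suc (suc k)))) (s≤s (s≤s (s≤s (s≤s z≤n)))) G fragile =
  (λ (x , x∈) (y , y∈) ¬e →
    let c , ok , eq = equal x∈ y∈ ¬e in c ∘ proj₁ , restrict ok , eq) ,
  (λ (x , x∈) (y , y∈) x≢y →
    let c , ok , xy = apart₂ x∈ y∈ (x≢y ∘ vertex-≡) in c ∘ proj₁ , restrict ok , xy) ,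
  (λ (x , x∈) (y , y∈) (z , z∈) x≢y x≢z _ →
    let c , ok , xy , xz = apart x∈ y∈ z∈ (x≢y ∘ vertex-≡) (x≢z ∘ vertex-≡)
    in c ∘ proj₁ , restrict ok , [ x≢y⇒x∉⁅y⁆ xy , x≢y⇒x∉⁅y⁆ xz ]′ ∘ x∈p∪q⁻ ⁅ c y ⁆ ⁅ c z ⁆) ,
  (λ (x , x∈) (y , y∈) (z , z∈) x≢y x≢z y≢z ¬t →
    let c , ok , t = two x∈ y∈ z∈ (x≢y ∘ vertex-≡) (x≢z ∘ vertex-≡) (y≢z ∘ vertex-≡) ¬t
    in c ∘ proj₁ , restrict ok , Two⇒∣∣≡2 t)
  where
  open Colourings G k
  open Flexible (proj₁ (fragile⇒flexible fragile (⊂-wellFounded (V G)) id))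

  -- Membership proofs are unique, so distinct vertices have distinct underlying elements.
  vertex-≡ : ∀ {i j} {p : i ∈ V G} {q : j ∈ V G} → i ≡ j → _≡_ {A = Vertex G} (i , p) (j , q)
  vertex-≡ refl = cong (_ ,_) ([]=-irrelevant _ _)

  restrict : ∀ {c} → Proper (V G) c → IsColouring G (4 + k) (c ∘ proj₁)
  restrict ok (_ , a∈) (_ , b∈) = ok a∈ b∈
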